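{- There exist a real $\alpha>0$ and an $n_0\in\mathbb{N}$ such that for every even $n\ge n_0$ there exists a $3$-regular graph on $n$ vertices for which $\alpha n$ cops are not enough to catch the robber, i.e. a $3$-regular graph $G$ on $n$ vertices with $\mathrm{ent}(G)>\alpha n$.
   Context: Graphs here are finite, simple and undirected. Entanglement game on a graph $G$ with $k$ cops: First the robber chooses a starting vertex, and all $k$ cops are outside the graph. In every turn, the cops either all stay where they are, or exactly one of them flies (from wherever it is, on or off the graph) to the current position of the robber. Regardless of which of these happened, the robber then has to move to a neighbor of his current position that is not occupied by a cop. If there is no such neighbor, the cops win. The robber wins if he can run away indefinitely. Both sides have full information. The entanglement number $\mathrm{ent}(G)$ is the minimal integer $k$ such that $k$ cops have a strategy to catch the robber on $G$. "$\alpha n$ cops are not enough" means that no integer number $k\le\alpha n$ of cops can catch the robber, i.e. $\mathrm{ent}(G)>\alpha n$. -}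

module Defs where

open import Data.Empty using (⊥)
open import Data.Fin.Base using (Fin)
open import Data.Fin.Properties using (any?; all?) renaming (_≟_ to _≟ᶠ_)
open import Data.Fin.Subset using (Subset; ∣_∣)
open import Data.List.Base as List using (List; []; _∷_; length; filter)
open import Data.List.Membership.Propositional using (_∈_)
open import Data.List.Membership.Propositional.Properties
  using (∈-map⁺; ∈-allFin; ∈-filter⁺; ∈-cartesianProduct⁺; ∈-cartesianProductWith⁺)
open import Data.List.Properties using (filter-notAll)
open import Data.List.Relation.Unary.Any as Any using (Any; here; there)
open import Data.Maybe.Base using (Maybe; just; nothing)
open import Data.Maybe.Properties using (≡-dec)
open import Data.Nat.Base using (ℕ; zero; suc; _≤_; _<_; s≤s⁻¹)
open import Data.Nat.Properties
  using (≤-refl; ≤-trans; m<1+n⇒m<n∨m≡n; ≮⇒≥)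
open import Data.Product.Base using (∃; ∃-syntax; _×_; _,_; proj₁; proj₂)
open import Data.Sum.Base using (_⊎_; inj₁; inj₂; [_,_]′)
open import Data.Vec.Base using (Vec; []; _∷_; tabulate; replicate; lookup; _[_]≔_)
open import Data.Vec.Membership.Propositional using () renaming (_∈_ to _∈ᵛ_; _∉_ to _∉ᵛ_)
open import Data.Vec.Membership.Propositional.Properties using (∈-lookup)
import Data.Vec.Membership.DecPropositional as DecMembership
open import Data.Vec.Properties using (lookup∘updateAt; lookup∘update′)
open import Level using (0ℓ)
open import Relation.Binary.Core using (Rel)
open import Relation.Binary.Definitions using (Decidable; Symmetric; Irreflexive)
open import Relation.Binary.PropositionalEquality
  using (_≡_; _≢_; refl; sym; trans; subst)
open import Relation.Nullary using (¬_; Dec; yes; no; does; contradiction; ¬?)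
open import Relation.Nullary.Decidable using (map′; _⊎-dec_; _→-dec_)

record Graph (n : ℕ) : Set₁ where
  infix 4 _~_ _~?_
  field
    _~_      : Rel (Fin n) 0ℓ
    _~?_     : Decidable _~_
    ~-sym    : Symmetric _~_
    ~-irrefl : Irreflexive _≡_ _~_

  neighbours : Fin n → Subset n
  neighbours v = tabulate (λ w → does (v ~? w))

  degree : Fin n → ℕ
  degree v = ∣ neighbours v ∣

Regular : ∀ {n} → ℕ → Graph n → Set
Regular d G = ∀ v → Graph.degree G v ≡ d

-- `nothing` is a cop outside the graph.
Cops : ℕ → ℕ → Set
Cops n k = Vec (Maybe (Fin n)) k

data CopMove {n k} (c : Cops n k) (r : Fin n) : Cops n k → Set where
  stay : CopMove c r c
  fly  : (i : Fin k) → CopMove c r (c [ i ]≔ just r)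

module _ {n} (G : Graph n) where
  open Graph G

  -- The cops are to move, with the robber at `r`.  An element is a
  -- winning strategy tree for the cops: it prescribes a cop move and a
  -- continuation for each legal answer of the robber.  Being inductive,
  -- it admits no infinite play; its leaves are the positions in which
  -- the robber has no legal answer.
  data CopsWin {k} (c : Cops n k) (r : Fin n) : Set where
    turn : ∀ {c′} → CopMove c r c′ →
           (∀ w → r ~ w → just w ∉ᵛ c′ → CopsWin c′ w) →
           CopsWin c r

  CanCatch : ℕ → Set
  CanCatch k = ∀ r → CopsWin (replicate k nothing) r

  IsEntanglement : ℕ → Set
  IsEntanglement k = CanCatch k × (∀ j → CanCatch j → k ≤ j)

  -- Wins within N turns.  On the finite set of positions this increasing
  -- chain becomes stationary, so the game is decidable.
  module _ {k : ℕ} where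

    CopsWinIn : ℕ → Cops n k → Fin n → Set
    After     : ℕ → Cops n k → Fin n → Set

    CopsWinIn zero    c r = ⊥
    CopsWinIn (suc N) c r = After N c r ⊎ ∃[ i ] After N (c [ i ]≔ just r) r

    After N c r = ∀ w → r ~ w → just w ∉ᵛ c → CopsWinIn N c w

    private
      open DecMembership (≡-dec (_≟ᶠ_ {n})) using (_∈?_)

      Position : Set
      Position = Cops n k × Fin n

      In : ℕ → Position → Set
      In N (c , r) = CopsWinIn N c r

    copsWinIn? : ∀ N c r → Dec (CopsWinIn N c r)
    after?     : ∀ N c r → Dec (After N c r)

    copsWinIn? zero    c r = no λ ()
    copsWinIn? (suc N) c r =
      after? N c r ⊎-dec any? (λ i → after? N (c [ i ]≔ just r) r)

    after? N c r =
      all? λ w → (r ~? w) →-dec (¬? (just w ∈? c) →-dec copsWinIn? N c w)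

    private
      in? : ∀ N p → Dec (In N p)
      in? N (c , r) = copsWinIn? N c r

    copsWinIn-suc : ∀ N {c r} → CopsWinIn N c r → CopsWinIn (suc N) c r
    copsWinIn-suc (suc N) (inj₁ f) =
      inj₁ λ w e o → copsWinIn-suc N (f w e o)
    copsWinIn-suc (suc N) (inj₂ (i , f)) =
      inj₂ (i , λ w e o → copsWinIn-suc N (f w e o))

    copsWinIn⇒copsWin : ∀ N {c r} → CopsWinIn N c r → CopsWin c r
    copsWinIn⇒copsWin (suc N) (inj₁ f) =
      turn stay λ w e o → copsWinIn⇒copsWin N (f w e o)
    copsWinIn⇒copsWin (suc N) (inj₂ (i , f)) =
      turn (fly i) λ w e o → copsWinIn⇒copsWin N (f w e o)

    Stationary : ℕ → Set
    Stationary N = ∀ {c r} → CopsWinIn (suc N) c r → CopsWinIn N c r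

    copsWin⇒copsWinIn : ∀ {N} → Stationary N →
                        ∀ {c r} → CopsWin c r → CopsWinIn N c r
    copsWin⇒copsWinIn st (turn stay f) =
      st (inj₁ λ w e o → copsWin⇒copsWinIn st (f w e o))
    copsWin⇒copsWinIn st (turn (fly i) f) =
      st (inj₂ (i , λ w e o → copsWin⇒copsWinIn st (f w e o)))

    private
      -- `ps` lists (at least) the positions not won within N turns.
      search : ∀ fuel N (ps : List Position) → length ps ≤ fuel →
               (∀ p → In N p ⊎ p ∈ ps) → ∃ Stationary
      search fuel N ps len cover with Any.any? (in? (suc N)) ps
      ... | no none = N , λ {c} {r} win →
        [ (λ h → h)
        , (λ m → contradiction (Any.map (λ { refl → win }) m) none)
        ]′ (cover (c , r))
      search zero    N [] len cover | yes ()
      search (suc m) N ps len cover | yes some =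
        search m (suc N) (filter open? ps)
          (s≤s⁻¹ (≤-trans
            (filter-notAll open? ps (Any.map (λ win ¬win → ¬win win) some)) len))
          cover′
        where
        open? : ∀ p → Dec (¬ In (suc N) p)
        open? p = ¬? (in? (suc N) p)

        cover′ : ∀ p → In (suc N) p ⊎ p ∈ filter open? ps
        cover′ p with in? (suc N) p | cover p
        ... | yes win | _        = inj₁ win
        ... | no ¬win | inj₁ win = contradiction (copsWinIn-suc N win) ¬win
        ... | no ¬win | inj₂ p∈  = inj₂ (∈-filter⁺ open? p∈ ¬win)

      places : List (Maybe (Fin n))
      places = nothing ∷ List.map just (List.allFin n)

      ∈-places : ∀ x → x ∈ places
      ∈-places nothing  = here refl
      ∈-places (just v) = there (∈-map⁺ just (∈-allFin v))

      allCops : ∀ m → List (Cops n m)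
      allCops zero    = [] ∷ []
      allCops (suc m) = List.cartesianProductWith _∷_ places (allCops m)

      ∈-allCops : ∀ {m} (c : Cops n m) → c ∈ allCops m
      ∈-allCops []      = here refl
      ∈-allCops (x ∷ c) = ∈-cartesianProductWith⁺ _∷_ (∈-places x) (∈-allCops c)

    stationary : ∃ Stationary
    stationary = search _ 0 (List.cartesianProduct (allCops k) (List.allFin n)) ≤-refl
      λ { (c , r) → inj₂ (∈-cartesianProduct⁺ (∈-allCops c) (∈-allFin r)) }

    copsWin? : ∀ (c : Cops n k) r → Dec (CopsWin c r)
    copsWin? c r =
      let N , st = stationary
      in map′ (copsWinIn⇒copsWin N) (copsWin⇒copsWinIn st) (copsWinIn? N c r)

  canCatch? : ∀ k → Dec (CanCatch k)
  canCatch? k = all? (copsWin? (replicate k nothing))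

  -- n cops suffice: cop v flies to v when the robber visits v.
  private
    sweep : ∀ fuel (vs : List (Fin n)) → length vs ≤ fuel → (c : Cops n n) →
            (∀ v → lookup c v ≡ just v ⊎ v ∈ vs) →
            ∀ r → r ∈ vs → CopsWin c r
    sweep zero    [] len c cover r ()
    sweep (suc m) vs len c cover r r∈ =
      turn (fly r) λ w _ w∉ →
        sweep m vs′
          (s≤s⁻¹ (≤-trans
            (filter-notAll new? vs (Any.map (λ r≡v v≢r → v≢r (sym r≡v)) r∈)) len))
          c′ cover′ w
          ([ (λ eq → contradiction (subst (_∈ᵛ c′) eq (∈-lookup w c′)) w∉)
           , (λ w∈ → w∈)
           ]′ (cover′ w))
      where
      new? : ∀ v → Dec (v ≢ r)
      new? v = ¬? (v ≟ᶠ r)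

      vs′ = filter new? vs
      c′  = c [ r ]≔ just r

      cover′ : ∀ v → lookup c′ v ≡ just v ⊎ v ∈ vs′
      cover′ v with v ≟ᶠ r | cover v
      ... | yes refl | _       = inj₁ (lookup∘updateAt r c)
      ... | no v≢r   | inj₁ eq = inj₁ (trans (lookup∘update′ v≢r c (just r)) eq)
      ... | no v≢r   | inj₂ v∈ = inj₂ (∈-filter⁺ new? v∈ v≢r)

  canCatch-n : CanCatch n
  canCatch-n r = sweep _ (List.allFin n) ≤-refl (replicate n nothing)
    (λ v → inj₂ (∈-allFin v)) r (∈-allFin r)

  private
    least : ∀ m → ∃ IsEntanglement ⊎ (∀ j → j < m → ¬ CanCatch j)
    least zero = inj₂ λ _ ()
    least (suc m) with least m
    ... | inj₁ found = inj₁ found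
    ... | inj₂ none with canCatch? m
    ...   | yes yesₘ = inj₁ (m , yesₘ , λ j can → ≮⇒≥ (λ j<m → none j j<m can))
    ...   | no  noₘ  = inj₂ λ j j<1+m can →
      [ (λ j<m → none j j<m can) , (λ { refl → noₘ can }) ]′ (m<1+n⇒m<n∨m≡n j<1+m)

  entanglement : ∃ IsEntanglement
  entanglement =
    [ (λ found → found) , (λ none → contradiction canCatch-n (none n ≤-refl)) ]′
      (least (suc n))

  ent : ℕ
  ent = proj₁ entanglement

  ent-isEntanglement : IsEntanglement ent
  ent-isEntanglement = proj₂ entanglement

{-# OPTIONS --safe #-}

-- Join N = 16t cycles of bounded length L by a partial matching such that any two disjoint sets
-- of at least 2t cycles are joined by a matching edge.  Such a matching is found greedily, as in
-- the greedy set cover: by averaging, some pair of cycles with unused points separates at least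
-- 1/256 of the pairs of sets not yet separated, so O(N) edges separate all 3^N of them.  Taking
-- the graph twice and joining the unmatched points to their twins makes it 3-regular.
--
-- Fewer than 2t cops leave at least 14t cycles untouched, and then one component meets at least
-- 10t of them.  More than half of the cycles being in it, two such components for different cop
-- positions meet.  Hence a robber in the large component can, whatever cop is flown to him,
-- leave along a path to the next large component that does not return to his vertex.

module Submission where

open import Defs
open import Data.Bool.Base using (Bool; true; false; not; _∧_; _∨_; T)
open import Data.Bool.Properties using (T-not-≡; T?; ∨-zeroʳ; not-involutive; not-¬)
  renaming (_≟_ to _≟ᵇ_)
open import Data.Fin.Base using (Fin; zero; suc; toℕ; fromℕ; fromℕ<; inject₁)
open import Data.Fin.Induction using (<-weakInduction)
open import Data.Fin.Properties
  using (sequence; toℕ-fromℕ<; toℕ-fromℕ; toℕ-inject₁; 2↔Bool; +↔⊎; *↔×)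
  renaming (_≟_ to _≟ᶠ_)
open import Data.Fin.Relation.Unary.Top using (view; ‵fromℕ; ‵inject₁; view-fromℕ; view-inject₁)
open import Data.Fin.Subset using (∣_∣)
open import Data.List.Base
  using (List; []; _∷_; length; map; filter; filterᵇ; allFin; cartesianProductWith)
open import Data.List.Membership.Propositional using (_∈_)
open import Data.List.Membership.Propositional.Properties
  using (∈-filter⁺; ∈-cartesianProductWith⁺; ∈-allFin)
open import Data.List.Properties using (length-map; length-++; length-filter)
open import Data.List.Relation.Unary.All as All using (All; []; _∷_)
open import Data.List.Relation.Unary.All.Properties using (filter⁺; all-filter)
open import Data.List.Relation.Unary.Any using (here; there)
open import Data.Maybe.Base using (Maybe; just; nothing; _>>=_)
open import Data.Maybe.Properties using (just-injective)
open import Data.Nat.Base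
open import Data.Nat.DivMod using (_/_; _%_; m≡m%n+[m/n]*n; m%n<n; m≥n⇒m/n>0)
open import Data.Nat.Divisibility using (_∣_; divides)
open import Data.Nat.Properties
open import Data.Nat.Tactic.RingSolver using (solve-∀)
open import Data.Product.Base using (Σ-syntax; ∃-syntax; _×_; _,_; proj₁; proj₂)
open import Data.Product.Function.NonDependent.Propositional using (_×-↔_)
open import Data.Product.Properties using (,-injectiveˡ; ,-injectiveʳ) renaming (≡-dec to ×-≡-dec)
open import Data.Rational.Base as ℚ using (ℚ; 0ℚ; toℚᵘ)
import Data.Rational.Properties as ℚ
open import Data.Rational.Unnormalised.Base as ℚᵘ using (mkℚᵘ; *<*)
import Data.Rational.Unnormalised.Properties as ℚᵘ
open import Data.Sum.Base using (_⊎_; inj₁; inj₂)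
open import Data.Sum.Function.Propositional using (_⊎-↔_)
open import Data.Sum.Properties using (inj₁-injective; inj₂-injective) renaming (≡-dec to ⊎-≡-dec)
open import Data.Unit.Base using (tt)
open import Data.Vec.Base using (Vec; []; _∷_; tabulate; lookup; replicate; _[_]≔_)
open import Data.Vec.Membership.Propositional using () renaming (_∈_ to _∈ᵛ_; _∉_ to _∉ᵛ_)
open import Data.Vec.Properties using (lookup∘tabulate)
import Data.Vec.Relation.Unary.Any as Anyᵛ
open import Effect.Monad using (RawMonad)
open import Function.Base using (_∘_; case_of_)
open import Function.Bundles using (Equivalence; Inverse; _↔_; mk⇔)
open import Function.Construct.Composition using (_↔-∘_)
open import Function.Construct.Identity using (↔-id)
open import Level using (0ℓ)
open import Relation.Binary.Definitions using (DecidableEquality)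
open import Relation.Binary.PropositionalEquality
  using (_≡_; _≢_; refl; sym; trans; cong; cong₂; subst; subst₂; module ≡-Reasoning)
open import Relation.Nullary using (¬_; Dec; yes; no; does; contradiction)
open import Relation.Nullary.Decidable
  using (_×-dec_; _⊎-dec_; does-⇔; ¬¬-excluded-middle; dec-true)
open import Relation.Nullary.Negation using (¬¬-Monad)

open import Algebra.Properties.CommutativeMonoid.Sum +-0-commutativeMonoid
  using (sum; ∑-distrib-+; sum-cong-≗; sum-replicate-zero)
open import Algebra.Properties.CommutativeSemigroup *-commutativeSemigroup
  using (interchange; xy∙z≈y∙xz; x∙yz≈y∙xz)

private variable
  n : ℕ
  X : Set

-- Counting and averaging over finite sets.

[_] : Bool → ℕ
[ false ] = 0
[ true  ] = 1

count : (Fin n → Bool) → ℕ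
count p = sum ([_] ∘ p)

sum-mono : {f g : Fin n → ℕ} → (∀ i → f i ≤ g i) → sum f ≤ sum g
sum-mono {zero}  f≤g = z≤n
sum-mono {suc n} f≤g = +-mono-≤ (f≤g zero) (sum-mono (f≤g ∘ suc))

sum-≤-+ : {f g h : Fin n → ℕ} → (∀ i → f i ≤ g i + h i) → sum f ≤ sum g + sum h
sum-≤-+ {g = g} {h} f≤ = ≤-trans (sum-mono f≤) (≤-reflexive (∑-distrib-+ g h))

sum-const : ∀ n c → sum {n} (λ _ → c) ≡ n * c
sum-const zero    c = refl
sum-const (suc n) c = cong (c +_) (sum-const n c)

sum-scale : ∀ c (f : Fin n → ℕ) → sum (λ i → c * f i) ≡ c * sum f
sum-scale {zero}  c f = sym (*-zeroʳ c)
sum-scale {suc n} c f =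
  trans (cong (c * f zero +_) (sum-scale c (f ∘ suc))) (sym (*-distribˡ-+ c _ _))

count-true : ∀ n → count {n} (λ _ → true) ≡ n
count-true n = trans (sum-const n 1) (*-identityʳ n)

count-≟ : (j : Fin n) → count (λ i → does (i ≟ᶠ j)) ≡ 1
count-≟ {suc n} zero    = cong suc (sum-replicate-zero n)
count-≟ {suc n} (suc j) = count-≟ j

∣tabulate∣ : (p : Fin n → Bool) → ∣ tabulate p ∣ ≡ count p
∣tabulate∣ {zero}  p = refl
∣tabulate∣ {suc n} p with p zero
... | true  = cong suc (∣tabulate∣ (p ∘ suc))
... | false = ∣tabulate∣ (p ∘ suc)

sum≤n*max : .{{_ : NonZero n}} (g : Fin n → ℕ) → ∃[ i ] sum g ≤ n * g i
sum≤n*max {suc n} g with argmax g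
  where
  argmax : ∀ {n} (g : Fin (suc n) → ℕ) → ∃[ i ] (∀ j → g j ≤ g i)
  argmax {zero}  g = zero , λ { zero → ≤-refl }
  argmax {suc n} g with argmax (g ∘ suc)
  ... | i , max with ≤-total (g zero) (g (suc i))
  ...   | inj₁ g0≤ = suc i , λ { zero → g0≤ ; (suc j) → max j }
  ...   | inj₂ g0≥ = zero , λ { zero → ≤-refl ; (suc j) → ≤-trans (max j) g0≥ }
... | i , max = i , ≤-trans (sum-mono max) (≤-reflexive (sum-const (suc n) (g i)))

length-filterᵇ-∷ : ∀ (p : X → Bool) x xs →
                   length (filterᵇ p (x ∷ xs)) ≡ [ p x ] + length (filterᵇ p xs)
length-filterᵇ-∷ p x xs with p x
... | true  = refl
... | false = refl

length-filterᵇ-not : ∀ (p : X → Bool) xs →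
  length (filterᵇ p xs) + length (filterᵇ (not ∘ p) xs) ≡ length xs
length-filterᵇ-not p []       = refl
length-filterᵇ-not p (x ∷ xs) with p x
... | true  = cong suc (length-filterᵇ-not p xs)
... | false = trans (+-suc _ _) (cong suc (length-filterᵇ-not p xs))

filterᵇ-filterᵇ : ∀ (p q : X → Bool) xs →
                  filterᵇ q (filterᵇ p xs) ≡ filterᵇ (λ x → p x ∧ q x) xs
filterᵇ-filterᵇ p q []       = refl
filterᵇ-filterᵇ p q (x ∷ xs) with p x
... | false = filterᵇ-filterᵇ p q xs
... | true with q x
...   | true  = cong (x ∷_) (filterᵇ-filterᵇ p q xs)
...   | false = filterᵇ-filterᵇ p q xs

-- Double counting of the pairs (x, i) with `h x i`: every x contributes at least `m`, and the best
-- of the `n` columns holds at least the average.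
popular : ∀ {m} .{{_ : NonZero n}} (h : X → Fin n → Bool) (xs : List X) →
          All (λ x → m ≤ count (h x)) xs →
          ∃[ i ] m * length xs ≤ n * length (filterᵇ (λ x → h x i) xs)
popular {X} {n} {m} h xs big with sum≤n*max (λ i → length (filterᵇ (λ x → h x i) xs))
... | i , le = i , ≤-trans (total xs big) le
  where
  total : ∀ xs → All (λ x → m ≤ count (h x)) xs →
          m * length xs ≤ sum (λ i → length (filterᵇ (λ x → h x i) xs))
  total []       []          = ≤-trans (≤-reflexive (*-zeroʳ m)) z≤n
  total (x ∷ xs) (px ∷ pxs) = begin
    m * suc (length xs)
      ≡⟨ *-suc m (length xs) ⟩
    m + m * length xs
      ≤⟨ +-mono-≤ px (total xs pxs) ⟩
    count (h x) + sum (λ i → length (filterᵇ (λ x → h x i) xs))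
      ≡⟨ ∑-distrib-+ ([_] ∘ h x) (λ i → length (filterᵇ (λ x → h x i) xs)) ⟨
    sum (λ i → [ h x i ] + length (filterᵇ (λ x → h x i) xs))
      ≡⟨ sum-cong-≗ (λ i → length-filterᵇ-∷ (λ x → h x i) x xs) ⟨
    sum (λ i → length (filterᵇ (λ x → h x i) (x ∷ xs))) ∎
    where open ≤-Reasoning

-- Adding one edge to a partial matching, encoded as an involution.

module Link {X : Set} (_≟_ : DecidableEquality X) (e f : X) (μ : X → X) where

  link : X → X
  link x with x ≟ e | x ≟ f
  ... | yes _ | _     = f
  ... | no  _ | yes _ = e
  ... | no  _ | no  _ = μ x

  link-e : link e ≡ f
  link-e with e ≟ e
  ... | yes _  = refl
  ... | no e≢e = contradiction refl e≢e

  link-f : e ≢ f → link f ≡ e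
  link-f e≢f with f ≟ e | f ≟ f
  ... | yes f≡e | _      = contradiction (sym f≡e) e≢f
  ... | no  _   | yes _  = refl
  ... | no  _   | no f≢f = contradiction refl f≢f

  link-other : ∀ {x} → x ≢ e → x ≢ f → link x ≡ μ x
  link-other {x} x≢e x≢f with x ≟ e | x ≟ f
  ... | yes x≡e | _       = contradiction x≡e x≢e
  ... | no  _   | yes x≡f = contradiction x≡f x≢f
  ... | no  _   | no  _   = refl

  module _ (e≢f : e ≢ f) (μ-invol : ∀ x → μ (μ x) ≡ x) (μe≡e : μ e ≡ e) (μf≡f : μ f ≡ f) where

    -- As `μ` fixes `e` and `f`, it sends no other point to either of them, so redirecting these two
    -- leaves the remaining pairs intact.
    link-invol : ∀ x → link (link x) ≡ x
    link-invol x with x ≟ e | x ≟ f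
    ... | yes x≡e | _       = trans (link-f e≢f) (sym x≡e)
    ... | no  _   | yes x≡f = trans link-e (sym x≡f)
    ... | no x≢e  | no x≢f  = trans (link-other (moved μe≡e x≢e) (moved μf≡f x≢f)) (μ-invol x)
      where
      moved : ∀ {y} → μ y ≡ y → x ≢ y → μ x ≢ y
      moved μy≡y x≢y μx≡y =
        x≢y (trans (sym (μ-invol x)) (trans (cong μ μx≡y) μy≡y))

-- Pairs of disjoint sets as three-valued colourings.

-- A colouring marks the blocks of two disjoint sets by `just true` and `just false`.
Colour : Set
Colour = Maybe Bool

inA inB : Colour → Bool
inA (just true)  = true
inA _            = false
inB (just false) = true
inB _            = false

inA∧inB : ∀ c → inA c ≡ true → inB c ≢ true
inA∧inB (just true) _ ()

-- On an overlap the first set wins; hence only `inB-colour` asks for disjointness.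
colour : Bool → Bool → Colour
colour true  _     = just true
colour false true  = just false
colour false false = nothing

inA-colour : ∀ a b → inA (colour a b) ≡ a
inA-colour true  _     = refl
inA-colour false true  = refl
inA-colour false false = refl

inB-colour : ∀ {a b} → (a ≡ true → b ≢ true) → inB (colour a b) ≡ b
inB-colour {true}  {true}  disjoint = contradiction refl (disjoint refl)
inB-colour {true}  {false} _        = refl
inB-colour {false} {true}  _        = refl
inB-colour {false} {false} _        = refl

colours : List Colour
colours = nothing ∷ just true ∷ just false ∷ []

∈-colours : ∀ c → c ∈ colours
∈-colours nothing      = here refl
∈-colours (just true)  = there (here refl)
∈-colours (just false) = there (there (here refl))

colourings : ∀ n → List (Vec Colour n)
colourings zero    = [] ∷ []
colourings (suc n) = cartesianProductWith _∷_ colours (colourings n)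

∈-colourings : ∀ {n} (v : Vec Colour n) → v ∈ colourings n
∈-colourings []      = here refl
∈-colourings (c ∷ v) = ∈-cartesianProductWith⁺ _∷_ (∈-colours c) (∈-colourings v)

length-cartesianProductWith : ∀ {A B C : Set} (f : A → B → C) xs ys →
  length (cartesianProductWith f xs ys) ≡ length xs * length ys
length-cartesianProductWith f []       ys = refl
length-cartesianProductWith f (x ∷ xs) ys =
  trans (length-++ (map (f x) ys))
        (cong₂ _+_ (length-map (f x) ys) (length-cartesianProductWith f xs ys))

length-colourings : ∀ n → length (colourings n) ≡ 3 ^ n
length-colourings zero    = refl
length-colourings (suc n) =
  trans (length-cartesianProductWith _∷_ colours (colourings n))
        (cong (3 *_) (length-colourings n))

-- Geometric decay in natural numbers.

^-distribʳ-* : ∀ n a b → (a * b) ^ n ≡ a ^ n * b ^ n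
^-distribʳ-* zero    a b = refl
^-distribʳ-* (suc n) a b =
  trans (cong (a * b *_) (^-distribʳ-* n a b)) (interchange a b (a ^ n) (b ^ n))

-- A loss of the factor q/(1+q) per step, with denominators cleared.
decay-step : ∀ q j {r r′ f} → suc q * r′ ≤ q * r → suc q ^ j * r ≤ q ^ j * f →
             suc q ^ suc j * r′ ≤ q ^ suc j * f
decay-step q j {r} {r′} {f} r′≤ r≤ = begin
  suc q * suc q ^ j * r′     ≡⟨ xy∙z≈y∙xz (suc q) (suc q ^ j) r′ ⟩
  suc q ^ j * (suc q * r′)   ≤⟨ *-monoʳ-≤ (suc q ^ j) r′≤ ⟩
  suc q ^ j * (q * r)        ≡⟨ x∙yz≈y∙xz (suc q ^ j) q r ⟩
  q * (suc q ^ j * r)        ≤⟨ *-monoʳ-≤ q r≤ ⟩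
  q * (q ^ j * f)            ≡⟨ *-assoc q (q ^ j) f ⟨
  q * q ^ j * f              ∎
  where open ≤-Reasoning

-- Removing at least the fraction 1/(1+q) of `r` leaves at most q/(1+q) of it; adding `suc q * h` to
-- both sides avoids subtraction.
remainder-≤ : ∀ q {h r′ r} → h + r′ ≡ r → r ≤ suc q * h → suc q * r′ ≤ q * r
remainder-≤ q {h} {r′} {r} h+r′≡r r≤ = +-cancelˡ-≤ (suc q * h) _ _ (begin
  suc q * h + suc q * r′  ≡⟨ *-distribˡ-+ (suc q) h r′ ⟨
  suc q * (h + r′)        ≡⟨ cong (suc q *_) h+r′≡r ⟩
  r + q * r               ≤⟨ +-monoˡ-≤ (q * r) r≤ ⟩
  suc q * h + q * r       ∎)
  where open ≤-Reasoning

-- The `t`-th power of the strict hypothesis shows that after `T * t` steps the decay beats the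
-- initial size, so fewer than one element remains. One numerical inequality thus serves every `t`.
exhausted : ∀ p q c m T t .{{_ : NonZero p}} .{{_ : NonZero t}} {r f} → c ^ m * q ^ T < p ^ T →
            f ≤ c ^ (m * t) → p ^ (T * t) * r ≤ q ^ (T * t) * f → r ≡ 0
exhausted p q c m T t {r} {f} c^m*q^T<p^T f≤ le = n<1⇒n≡0 (*-cancelˡ-< (p ^ (T * t)) _ 1 (begin-strict
  p ^ (T * t) * r              ≤⟨ le ⟩
  q ^ (T * t) * f              ≤⟨ *-monoʳ-≤ (q ^ (T * t)) f≤ ⟩
  q ^ (T * t) * c ^ (m * t)    ≡⟨ cong₂ _*_ (^-*-assoc q T t) (^-*-assoc c m t) ⟨
  (q ^ T) ^ t * (c ^ m) ^ t    ≡⟨ ^-distribʳ-* t (q ^ T) (c ^ m) ⟨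
  (q ^ T * c ^ m) ^ t          ≡⟨ cong (_^ t) (*-comm (q ^ T) (c ^ m)) ⟩
  (c ^ m * q ^ T) ^ t          <⟨ ^-monoˡ-< t c^m*q^T<p^T ⟩
  (p ^ T) ^ t                  ≡⟨ ^-*-assoc p T t ⟩
  p ^ (T * t)                  ≡⟨ *-identityʳ _ ⟨
  p ^ (T * t) * 1              ∎))
  where open ≤-Reasoning

nonempty-filterᵇ : ∀ {A : Set} c (p : A → Bool) xs → 0 < c * length (filterᵇ p xs) → ∃[ x ] T (p x)
nonempty-filterᵇ c p xs 0< with filterᵇ p xs | all-filter (λ x → T? (p x)) xs
... | []    | _       = contradiction (*-zeroʳ c) (>⇒≢ 0<)
... | x ∷ _ | px ∷ _  = x , px

-- The greedy matching between blocks.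

-- Per unit of `t` there are `m` blocks and `T₀` matching edges. Averaging costs a factor `m` at
-- each end of an edge, whence `suc q = m * m`; `decay` says that `T₀` edges outweigh the `3 ^ m`
-- colourings of `m` blocks.
module Design (m q t T₀ : ℕ) .{{_ : NonZero m}} .{{_ : NonZero t}} .{{_ : NonZero T₀}}
              (m*m≡1+q : m * m ≡ suc q) (decay : 3 ^ m * q ^ T₀ < suc q ^ T₀) where

  N L : ℕ
  N = m * t
  L = 2 * T₀

  instance
    N≢0 : NonZero N
    N≢0 = m*n≢0 m t
    L≢0 : NonZero L
    L≢0 = m*n≢0 2 T₀

  Point : Set
  Point = Fin N × Fin L

  _≟ₚ_ : DecidableEquality Point
  _≟ₚ_ = ×-≡-dec _≟ᶠ_ _≟ᶠ_

  Large : (Fin N → Colour) → Set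
  Large χ = 2 * t ≤ count (inA ∘ χ) × 2 * t ≤ count (inB ∘ χ)

  Hit : (Point → Point) → (Fin N → Colour) → Set
  Hit μ χ = ∃[ x ] (μ x ≢ x × inA (χ (proj₁ x)) ≡ true × inB (χ (proj₁ (μ x))) ≡ true)

  large? : ∀ v → Dec (Large (lookup v))
  large? v = 2 * t ≤? count (inA ∘ lookup v) ×-dec 2 * t ≤? count (inB ∘ lookup v)

  family : List (Vec Colour N)
  family = filter large? (colourings N)

  -- The state after `j` steps. Members of `family` not yet separated by an edge of `μ` are kept in
  -- `rest`, and `decayed` bounds its length by (q/(1+q))^j times that of `family`.
  record Stage (j : ℕ) : Set where
    field
      μ       : Point → Point
      μ-invol : ∀ x → μ (μ x) ≡ x
      μ-far   : ∀ x → μ x ≡ x ⊎ proj₁ (μ x) ≢ proj₁ x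
      -- Each block hands out its points in increasing order.
      used    : Fin N → ℕ
      fresh   : ∀ {a p} → used a ≤ toℕ p → μ (a , p) ≡ (a , p)
      sum-used : sum used ≤ 2 * j
      rest    : List (Vec Colour N)
      large   : All (Large ∘ lookup) rest
      covered : ∀ {v} → v ∈ family → v ∈ rest ⊎ Hit μ (lookup v)
      decayed : suc q ^ j * length rest ≤ q ^ j * length family

  initial : Stage 0
  initial = record
    { μ = λ x → x ; μ-invol = λ _ → refl ; μ-far = λ _ → inj₁ refl
    ; used = λ _ → 0 ; fresh = λ _ → refl
    ; sum-used = ≤-reflexive (trans (sum-const N 0) (*-zeroʳ N))
    ; rest = family ; large = all-filter large? (colourings N)
    ; covered = inj₁ ; decayed = ≤-refl }

  module Free (used : Fin N → ℕ) where

    free : Fin N → Bool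
    free a = used a <ᵇ L

    hA hB : Vec Colour N → Fin N → Bool
    hA v a = inA (lookup v a) ∧ free a
    hB v b = inB (lookup v b) ∧ free b

    hit : Fin N → Fin N → Vec Colour N → Bool
    hit a b v = hA v a ∧ hB v b

    hit⇒ : ∀ a b v → T (hit a b v) →
           (inA (lookup v a) ≡ true × T (free a)) × (inB (lookup v b) ≡ true × T (free b))
    hit⇒ a b v Tv with inA (lookup v a) | free a | inB (lookup v b) | free b
    ... | true | true | true | true = (refl , _) , (refl , _)

  module Popular (used : Fin N → ℕ) (sum-used : sum used ≤ t * L) where
    open Free used

    -- A block that is not free has used up `L` points, and at most `t * L` are used in total. A set
    -- of `2 * t` blocks therefore keeps at least `t` free ones.
    count-busy : count (not ∘ free) ≤ t
    count-busy = *-cancelʳ-≤ _ t L (begin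
      count (not ∘ free) * L              ≡⟨ *-comm (count (not ∘ free)) L ⟩
      L * count (not ∘ free)              ≡⟨ sum-scale L ([_] ∘ not ∘ free) ⟨
      sum (λ a → L * [ not (free a) ])    ≤⟨ sum-mono busy ⟩
      sum used                            ≤⟨ sum-used ⟩
      t * L                               ∎)
      where
      open ≤-Reasoning
      busy : ∀ a → L * [ not (free a) ] ≤ used a
      busy a with used a <ᵇ L in eq
      ... | true  = ≤-trans (≤-reflexive (*-zeroʳ L)) z≤n
      ... | false = ≤-trans (≤-reflexive (*-identityʳ L))
                            (≮⇒≥ λ u<L → subst T eq (<⇒<ᵇ u<L))

    count-free : (s : Fin N → Bool) → 2 * t ≤ count s → t ≤ count (λ a → s a ∧ free a)
    count-free s 2t≤ = +-cancelʳ-≤ t _ _ (begin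
      t + t                                           ≡⟨ cong (t +_) (+-identityʳ t) ⟨
      2 * t                                           ≤⟨ 2t≤ ⟩
      count s                                         ≤⟨ sum-≤-+ split ⟩
      count (λ a → s a ∧ free a) + count (not ∘ free) ≤⟨ +-monoʳ-≤ _ count-busy ⟩
      count (λ a → s a ∧ free a) + t                  ∎)
      where
      open ≤-Reasoning
      split : ∀ a → [ s a ] ≤ [ s a ∧ free a ] + [ not (free a) ]
      split a with s a | free a
      ... | false | _     = z≤n
      ... | true  | true  = s≤s z≤n
      ... | true  | false = s≤s z≤n

    -- Each colouring has at least `t` free blocks in the set, out of `N = m * t`, so some block
    -- serves a fraction 1/m of the colourings.
    frequent : (h : Vec Colour N → Fin N → Bool) (vs : List (Vec Colour N)) →
               All (λ v → 2 * t ≤ count (h v)) vs →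
               ∃[ a ] length vs ≤ m * length (filterᵇ (λ v → h v a ∧ free a) vs)
    frequent h vs big
      with popular (λ v a → h v a ∧ free a) vs (All.map (λ {v} → count-free (h v)) big)
    ... | a , le = a , *-cancelˡ-≤ t (≤-trans le (≤-reflexive (xy∙z≈y∙xz m t _)))

    -- Averaging twice: first choose `a` for the set A, then `b` for the set B among the colourings
    -- that `a` already serves.
    popular-pair : ∀ rest → All (Large ∘ lookup) rest →
                   ∃[ a ] ∃[ b ] length rest ≤ suc q * length (filterᵇ (hit a b) rest)
    popular-pair rest large with frequent (λ v → inA ∘ lookup v) rest (All.map proj₁ large)
    ... | a , le-a with frequent (λ v → inB ∘ lookup v) (filterᵇ (λ v → hA v a) rest)
                          (All.map proj₂ (filter⁺ (λ v → T? (hA v a)) large))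
    ...   | b , le-b = a , b , (begin
      length rest                        ≤⟨ le-a ⟩
      m * length (filterᵇ (λ v → hA v a) rest)
                                         ≤⟨ *-monoʳ-≤ m le-b ⟩
      m * (m * length rest-ab)           ≡⟨ *-assoc m m (length rest-ab) ⟨
      m * m * length rest-ab             ≡⟨ cong₂ (λ c vs → c * length vs) m*m≡1+q
                                              (filterᵇ-filterᵇ (λ v → hA v a) (λ v → hB v b) rest) ⟩
      suc q * length (filterᵇ (hit a b) rest)  ∎)
      where
      open ≤-Reasoning
      rest-ab : List (Vec Colour N)
      rest-ab = filterᵇ (λ v → hB v b) (filterᵇ (λ v → hA v a) rest)

  module Join {j} (st : Stage j) (a b : Fin N) (v₀ : Vec Colour N)
              (v₀-hit : T (Free.hit (Stage.used st) a b v₀))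
              (rest≤hit : length (Stage.rest st) ≤
                          suc q * length (filterᵇ (Free.hit (Stage.used st) a b) (Stage.rest st))) where
    open Stage st
    open Free used hiding (hit; hit⇒)

    hit : Vec Colour N → Bool
    hit = Free.hit used a b

    hit⇒ : ∀ v → T (hit v) →
           (inA (lookup v a) ≡ true × T (free a)) × (inB (lookup v b) ≡ true × T (free b))
    hit⇒ = Free.hit⇒ used a b

    rest′ : List (Vec Colour N)
    rest′ = filterᵇ (not ∘ hit) rest

    rest′≤ : suc q * length rest′ ≤ q * length rest
    rest′≤ = remainder-≤ q (length-filterᵇ-not hit rest) rest≤hit

    free-a : used a < L
    free-a = <ᵇ⇒< _ _ (proj₂ (proj₁ (hit⇒ v₀ v₀-hit)))

    free-b : used b < L
    free-b = <ᵇ⇒< _ _ (proj₂ (proj₂ (hit⇒ v₀ v₀-hit)))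

    a≢b : a ≢ b
    a≢b eq with hit⇒ v₀ v₀-hit
    ... | (inA≡ , _) , (inB≡ , _) = inA∧inB (lookup v₀ a) inA≡
      (subst (λ c → inB (lookup v₀ c) ≡ true) (sym eq) inB≡)

    e f : Point
    e = a , fromℕ< free-a
    f = b , fromℕ< free-b

    e≢f : e ≢ f
    e≢f = a≢b ∘ ,-injectiveˡ

    μe≡e : μ e ≡ e
    μe≡e = fresh (≤-reflexive (sym (toℕ-fromℕ< free-a)))

    μf≡f : μ f ≡ f
    μf≡f = fresh (≤-reflexive (sym (toℕ-fromℕ< free-b)))

    open Link _≟ₚ_ e f μ

    far : ∀ x → link x ≡ x ⊎ proj₁ (link x) ≢ proj₁ x
    far x with x ≟ₚ e | x ≟ₚ f
    ... | yes refl | _        = inj₂ (a≢b ∘ sym)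
    ... | no _     | yes refl = inj₂ a≢b
    ... | no _     | no _     = μ-far x

    used′ : Fin N → ℕ
    used′ i = used i + ([ does (i ≟ᶠ a) ] + [ does (i ≟ᶠ b) ])

    sum-used′ : sum used′ ≤ 2 * suc j
    sum-used′ = begin
      sum used′
        ≡⟨ ∑-distrib-+ used _ ⟩
      sum used + sum (λ i → [ does (i ≟ᶠ a) ] + [ does (i ≟ᶠ b) ])
        ≡⟨ cong (sum used +_) (∑-distrib-+ (λ i → [ does (i ≟ᶠ a) ]) _) ⟩
      sum used + (count (λ i → does (i ≟ᶠ a)) + count (λ i → does (i ≟ᶠ b)))
        ≡⟨ cong (sum used +_) (cong₂ _+_ (count-≟ a) (count-≟ b)) ⟩
      sum used + 2
        ≤⟨ +-monoˡ-≤ 2 sum-used ⟩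
      2 * j + 2
        ≡⟨ trans (+-comm (2 * j) 2) (sym (*-suc 2 j)) ⟩
      2 * suc j ∎
      where open ≤-Reasoning

    used<used′a : used a < used′ a
    used<used′a with a ≟ᶠ a
    ... | yes _  = m<m+n (used a) (s≤s z≤n)
    ... | no a≢a = contradiction refl a≢a

    used<used′b : used b < used′ b
    used<used′b with b ≟ᶠ b
    ... | yes _  = m<m+n (used b) (≤-trans (s≤s z≤n) (m≤n+m 1 _))
    ... | no b≢b = contradiction refl b≢b

    fresh′ : ∀ {c p} → used′ c ≤ toℕ p → link (c , p) ≡ (c , p)
    fresh′ {c} {p} u′≤p = trans
      (link-other
        (λ { refl → <⇒≱ used<used′a (≤-trans u′≤p (≤-reflexive (toℕ-fromℕ< free-a))) })
        (λ { refl → <⇒≱ used<used′b (≤-trans u′≤p (≤-reflexive (toℕ-fromℕ< free-b))) }))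
      (fresh (≤-trans (m≤m+n _ _) u′≤p))

    -- Earlier hits survive because a matched point is neither `e` nor `f`; a colouring dropped from
    -- `rest` is hit by the new edge.
    covered′ : ∀ {v} → v ∈ family → v ∈ rest′ ⊎ Hit link (lookup v)
    covered′ {v} v∈ with covered v∈
    ... | inj₂ (x , μx≢x , Ax , Bμx) = inj₂
      (x , subst (_≢ x) (sym link≡μ) μx≢x , Ax ,
       subst (λ y → inB (lookup v (proj₁ y)) ≡ true) (sym link≡μ) Bμx)
      where
      link≡μ : link x ≡ μ x
      link≡μ = link-other (λ { refl → μx≢x μe≡e }) (λ { refl → μx≢x μf≡f })
    ... | inj₁ v∈rest with hit v in eq
    ...   | false = inj₁ (∈-filter⁺ (λ v → T? (not (hit v))) v∈rest (Equivalence.from T-not-≡ eq))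
    ...   | true with hit⇒ v (subst T (sym eq) _)
    ...     | (Aa , _) , (Bb , _) = inj₂
      (e , (λ eq → e≢f (trans (sym eq) link-e)) , Aa ,
       subst (λ y → inB (lookup v (proj₁ y)) ≡ true) (sym link-e) Bb)

    decayed′ : suc q ^ suc j * length rest′ ≤ q ^ suc j * length family
    decayed′ = decay-step q j rest′≤ decayed

    next : Stage (suc j)
    next = record
      { μ = link ; μ-invol = link-invol e≢f μ-invol μe≡e μf≡f ; μ-far = far
      ; used = used′ ; fresh = fresh′ ; sum-used = sum-used′
      ; rest = rest′ ; large = filter⁺ (λ v → T? (not (hit v))) large
      ; covered = covered′ ; decayed = decayed′ }

  step : ∀ {j} → 2 * j ≤ t * L → Stage j → Stage (suc j)
  step {j} 2j≤tL st with Stage.rest st in eq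
  ... | _ ∷ _ = Join.next st (proj₁ pair) (proj₁ (proj₂ pair))
                  (proj₁ hit-exists) (proj₂ hit-exists) rest≤hit
    where
    open Stage st
    open Free used using (hit)
    pair : ∃[ a ] ∃[ b ] length rest ≤ suc q * length (filterᵇ (hit a b) rest)
    pair = Popular.popular-pair used (≤-trans sum-used 2j≤tL) rest large
    rest≤hit : length rest ≤ suc q * length (filterᵇ (hit (proj₁ pair) (proj₁ (proj₂ pair))) rest)
    rest≤hit = proj₂ (proj₂ pair)
    hit-exists : ∃[ v ] T (hit (proj₁ pair) (proj₁ (proj₂ pair)) v)
    hit-exists = nonempty-filterᵇ (suc q) _ rest
      (<-≤-trans (subst (λ vs → 0 < length vs) (sym eq) z<s) rest≤hit)
  -- With nothing left to separate no edge is added and only the index advances; the decay bound is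
  -- then trivial.
  ... | []    = record
    { μ = μ ; μ-invol = μ-invol ; μ-far = μ-far ; used = used ; fresh = fresh
    ; sum-used = ≤-trans sum-used (*-monoʳ-≤ 2 (n≤1+n j))
    ; rest = rest ; large = large ; covered = covered
    ; decayed = ≤-trans (≤-reflexive (trans (cong (λ vs → suc q ^ suc j * length vs) eq)
                                            (*-zeroʳ (suc q ^ suc j)))) z≤n }
    where open Stage st

  stages : ∀ j → 2 * j ≤ t * L → Stage j
  stages zero    _  = initial
  stages (suc j) le = step le′ (stages j le′)
    where
    le′ : 2 * j ≤ t * L
    le′ = ≤-trans (*-monoʳ-≤ 2 (n≤1+n j)) le

  -- The length `L = 2 * T₀` is what makes the `2 * (T₀ * t)` endpoints fit the budget `t * L`.
  final : Stage (T₀ * t)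
  final = stages (T₀ * t) (≤-reflexive (trans (sym (*-assoc 2 T₀ t)) (*-comm L t)))

  open Stage final public using (μ; μ-invol; μ-far)
  open Stage final using (rest; covered; decayed)

  length-family : length family ≤ 3 ^ N
  length-family = ≤-trans (length-filter large? (colourings N)) (≤-reflexive (length-colourings N))

  rest≡[] : length rest ≡ 0
  rest≡[] = exhausted (suc q) q 3 m T₀ t decay length-family decayed

  hits : ∀ χ → Large χ → Hit μ χ
  hits χ (A≥ , B≥)
    with rest | rest≡[] | covered (∈-filter⁺ large? (∈-colourings (tabulate χ)) large′)
    where
    lookup-χ : ∀ i → χ i ≡ lookup (tabulate χ) i
    lookup-χ i = sym (lookup∘tabulate χ i)
    large′ : Large (lookup (tabulate χ))
    large′ = ≤-trans A≥ (sum-mono λ i → ≤-reflexive (cong ([_] ∘ inA) (lookup-χ i)))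
           , ≤-trans B≥ (sum-mono λ i → ≤-reflexive (cong ([_] ∘ inB) (lookup-χ i)))
  ... | [] | _ | inj₂ (x , μx≢x , Ax , Bμx) =
    x , μx≢x , trans (cong inA (sym (lookup∘tabulate χ _))) Ax
             , trans (cong inB (sym (lookup∘tabulate χ _))) Bμx

-- Cop moves and paths that avoid the cops.

-- Lets connectivity be treated as decided for all pairs of blocks at once; this suffices because
-- the claims about the game end in a negation.
¬¬-∀ : ∀ {n} {P : Fin n → Set} → (∀ i → ¬ ¬ P i) → ¬ ¬ (∀ i → P i)
¬¬-∀ = sequence (RawMonad.rawApplicative (¬¬-Monad {0ℓ}))

∈-[]≔ : ∀ {A : Set} {k} (c : Vec A k) i {x y} → x ∈ᵛ c [ i ]≔ y → x ∈ᵛ y ∷ c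
∈-[]≔ (_ ∷ c) zero    (Anyᵛ.here x≡y)  = Anyᵛ.here x≡y
∈-[]≔ (_ ∷ c) zero    (Anyᵛ.there x∈)  = Anyᵛ.there (Anyᵛ.there x∈)
∈-[]≔ (_ ∷ c) (suc i) (Anyᵛ.here x≡z)  = Anyᵛ.there (Anyᵛ.here x≡z)
∈-[]≔ (_ ∷ c) (suc i) (Anyᵛ.there x∈)  with ∈-[]≔ c i x∈
... | Anyᵛ.here x≡y = Anyᵛ.here x≡y
... | Anyᵛ.there x∈c = Anyᵛ.there (Anyᵛ.there x∈c)

-- After either kind of move the cops stand on places of `c` or on `r`, so the robber can plan
-- against `just r ∷ c` whatever the cops do.
∈-CopMove : ∀ {n k} {c c′ : Cops n k} {r} → CopMove c r c′ →
            ∀ {x} → x ∈ᵛ c′ → x ∈ᵛ just r ∷ c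
∈-CopMove stay      = Anyᵛ.there
∈-CopMove (fly i) = ∈-[]≔ _ i

module _ {n} (G : Graph n) where
  open Graph G

  data Path {k} (c : Cops n k) : Fin n → Fin n → Set where
    nil : ∀ {u} → just u ∉ᵛ c → Path c u u
    cons : ∀ {u v w} → just u ∉ᵛ c → u ~ v → Path c v w → Path c u w

  module _ {k} {c : Cops n k} where

    source∉ : ∀ {u v} → Path c u v → just u ∉ᵛ c
    source∉ (nil u∉)     = u∉
    source∉ (cons u∉ _ _) = u∉

    target∉ : ∀ {u v} → Path c u v → just v ∉ᵛ c
    target∉ (nil u∉)    = u∉
    target∉ (cons _ _ p) = target∉ p

    _++ᵖ_ : ∀ {u v w} → Path c u v → Path c v w → Path c u w
    nil _        ++ᵖ q = q
    cons u∉ u~v p ++ᵖ q = cons u∉ u~v (p ++ᵖ q)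

    reverseᵖ : ∀ {u v} → Path c u v → Path c v u
    reverseᵖ (nil u∉)       = nil u∉
    reverseᵖ (cons u∉ u~v p) = reverseᵖ p ++ᵖ cons (source∉ p) (~-sym u~v) (nil u∉)

    weaken : ∀ {j} {d : Cops n j} → (∀ {x} → x ∈ᵛ d → x ∈ᵛ c) → ∀ {u v} → Path c u v → Path d u v
    weaken d⊆c (nil u∉)       = nil (u∉ ∘ d⊆c)
    weaken d⊆c (cons u∉ u~v p) = cons (u∉ ∘ d⊆c) u~v (weaken d⊆c p)

  module _ {k} {c : Cops n k} {r : Fin n} where

    ∉-∷ : ∀ {u} → u ≢ r → just u ∉ᵛ c → just u ∉ᵛ just r ∷ c
    ∉-∷ u≢r u∉ (Anyᵛ.here eq)  = u≢r (just-injective eq)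
    ∉-∷ u≢r u∉ (Anyᵛ.there u∈) = u∉ u∈

    -- Induction from the far end: the first visit to `r` met in this order is the last one along
    -- the path, and what follows it avoids `r`.
    avoid-or-leave : ∀ {u v} → v ≢ r → Path c u v →
                     Path (just r ∷ c) u v ⊎ ∃[ w ] (r ~ w × Path (just r ∷ c) w v)
    avoid-or-leave v≢r (nil u∉) = inj₁ (nil (∉-∷ v≢r u∉))
    avoid-or-leave v≢r (cons {u} u∉ u~w p) with avoid-or-leave v≢r p
    ... | inj₂ found = inj₂ found
    ... | inj₁ q with u ≟ᶠ r
    ...   | yes refl = inj₂ (_ , u~w , q)
    ...   | no u≢r   = inj₁ (cons (∉-∷ u≢r u∉) u~w q)

    after-last-visit : ∀ {v} → v ≢ r → Path c r v → ∃[ w ] (r ~ w × Path (just r ∷ c) w v)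
    after-last-visit v≢r p with avoid-or-leave v≢r p
    ... | inj₂ found = found
    -- The path starts at `r`, so it cannot avoid `r`.
    ... | inj₁ q     = contradiction (Anyᵛ.here refl) (source∉ q)

-- The robber's strategy in an expanding family of blocks.

module Robber
  {n N L t} .{{_ : NonZero t}} (G : Graph n) (N≡16t : N ≡ 16 * t)
  (vertex : Fin N → Fin L → Fin n) (home : Fin n → Maybe (Fin N))
  (home-vertex : ∀ b p → home (vertex b p) ≡ just b)
  (base : Fin L)
  (block-path : ∀ {k} {c : Cops n k} b → (∀ p → just (vertex b p) ∉ᵛ c) →
                ∀ p q → Path G c (vertex b p) (vertex b q))
  (hits : (A B : Fin N → Bool) → (∀ b → A b ≡ true → B b ≢ true) →
          2 * t ≤ count A → 2 * t ≤ count B →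
          ∃[ a ] ∃[ p ] ∃[ b ] ∃[ q ] (A a ≡ true × B b ≡ true × Graph._~_ G (vertex a p) (vertex b q)))
  where
  open Graph G

  centre : Fin N → Fin n
  centre b = vertex b base

  -- The robber stands in a component meeting at least 10t of the 16t blocks, which is more than
  -- half of them.
  Good : ∀ {k} → Cops n k → Fin n → Set
  Good c r = Σ[ S ∈ (Fin N → Bool) ] (10 * t ≤ count S × (∀ b → S b ≡ true → Path G c r (centre b)))

  at : Maybe (Fin N) → Fin N → ℕ
  at nothing   b = 0
  at (just b′) b = [ does (b ≟ᶠ b′) ]

  sum-at : ∀ x → sum (at x) ≤ 1
  sum-at nothing  = ≤-trans (≤-reflexive (sum-replicate-zero N)) z≤n
  sum-at (just b) = ≤-reflexive (count-≟ b)

  -- The number of cops assigned to block `b` by `home`; its sum over all blocks is at most the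
  -- number of cops.
  load : ∀ {k} → Cops n k → Fin N → ℕ
  load []      b = 0
  load (x ∷ c) b = at (x >>= home) b + load c b

  sum-load : ∀ {k} (c : Cops n k) → sum (load c) ≤ k
  sum-load []      = ≤-reflexive (sum-replicate-zero N)
  sum-load (x ∷ c) = ≤-trans (≤-reflexive (∑-distrib-+ (at (x >>= home)) (load c)))
                             (+-mono-≤ (sum-at (x >>= home)) (sum-load c))

  load-∈ : ∀ {k} {c : Cops n k} {b p} → just (vertex b p) ∈ᵛ c → load c b ≢ 0
  load-∈ {b = b} {p} (Anyᵛ.here refl) eq rewrite home-vertex b p | dec-true (b ≟ᶠ b) refl =
    contradiction eq λ ()
  load-∈ {c = x ∷ c} {b} (Anyᵛ.there v∈) eq = load-∈ v∈ (m+n≡0⇒n≡0 (at (x >>= home) b) eq)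

  module Components {k} (c : Cops n k) (k≤2t : k ≤ 2 * t)
                    (connected? : ∀ i b → Dec (Path G c (centre i) (centre b))) where

    clean : Fin N → Bool
    clean b = load c b ≡ᵇ 0

    clean⇒∉ : ∀ {b} → clean b ≡ true → ∀ p → just (vertex b p) ∉ᵛ c
    clean⇒∉ {b} eq p v∈ with load c b | load-∈ v∈
    ... | zero | ≢0 = ≢0 refl

    1≤clean+load : ∀ b → 1 ≤ [ clean b ] + load c b
    1≤clean+load b with load c b
    ... | zero  = s≤s z≤n
    ... | suc _ = s≤s z≤n

    component : Fin N → Fin N → Bool
    component i b = clean b ∧ does (connected? i b)

    union : List (Fin N) → Fin N → Bool
    union []       b = false
    union (i ∷ is) b = component i b ∨ union is b

    outside : List (Fin N) → Fin N → Bool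
    outside is b = clean b ∧ not (union is b)

    component⇒ : ∀ i b → component i b ≡ true → clean b ≡ true × Path G c (centre i) (centre b)
    component⇒ i b eq with clean b | connected? i b
    component⇒ i b refl | true | yes p = refl , p

    ⇒component : ∀ i b → clean b ≡ true → Path G c (centre i) (centre b) → component i b ≡ true
    ⇒component i b clean-b p rewrite clean-b | dec-true (connected? i b) p = refl

    union⇒ : ∀ is b → union is b ≡ true → ∃[ i ] (i ∈ is × component i b ≡ true)
    union⇒ (i ∷ is) b eq with component i b in eqᵢ
    ... | true  = i , here refl , eqᵢ
    ... | false with union⇒ is b eq
    ...   | j , j∈ , eqⱼ = j , there j∈ , eqⱼ

    ⇒union : ∀ {is i} b → i ∈ is → component i b ≡ true → union is b ≡ true
    ⇒union b (here refl) eq rewrite eq = refl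
    ⇒union b (there {x = j} i∈) eq rewrite ⇒union b i∈ eq = ∨-zeroʳ (component j b)

    outside⇒ : ∀ is b → outside is b ≡ true → clean b ≡ true × union is b ≡ false
    outside⇒ is b eq with clean b | union is b
    outside⇒ is b refl | true | false = refl , refl

    -- Such an edge, together with walks inside the two clean blocks, would put `b` into the
    -- component of `a`.
    closed : ∀ is {a p b q} → union is a ≡ true → outside is b ≡ true → ¬ vertex a p ~ vertex b q
    closed is {a} {p} {b} {q} a∈ b∉ a~b with union⇒ is a a∈ | outside⇒ is b b∉
    ... | i , i∈ , a∈i | clean-b , b∉is with component⇒ i a a∈i
    ...   | clean-a , path-a =
      contradiction (trans (sym b∉is) (⇒union b i∈ (⇒component i b clean-b path-b))) λ ()
      where
      path-b : Path G c (centre i) (centre b)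
      path-b = path-a ++′ (block-path a (clean⇒∉ clean-a) base p
                 ++′ cons (clean⇒∉ clean-a p) a~b (block-path b (clean⇒∉ clean-b) q base))
        where
        _++′_ = _++ᵖ_ G

    -- Otherwise `hits` yields an edge that `closed` forbids.
    outside-small : ∀ is → 2 * t ≤ count (union is) → count (outside is) ≤ 2 * t
    outside-small is U≥ with 2 * t ≤? count (outside is)
    ... | no W≱  = <⇒≤ (≰⇒> W≱)
    ... | yes W≥ with hits (union is) (outside is)
                        (λ b b∈ b∉ → contradiction (trans (sym b∈) (proj₂ (outside⇒ is b b∉))) λ ())
                        U≥ W≥
    ...   | a , p , b , q , a∈ , b∉ , a~b = contradiction a~b (closed is a∈ b∉)

    -- Components are added one by one. When the union first reaches 2t, the old union, the outside
    -- and the cops account for at most 2t blocks each, so the component just added has at least 16t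
    -- - 6t = 10t.
    grow : ∀ is → (∃[ i ] 10 * t ≤ count (component i)) ⊎ count (union is) ≤ 2 * t
    grow [] = inj₂ (≤-trans (≤-reflexive (sum-replicate-zero N)) z≤n)
    grow (i ∷ is) with grow is
    ... | inj₁ found = inj₁ found
    ... | inj₂ U≤ with 2 * t ≤? count (union (i ∷ is))
    ...   | no U′≱ = inj₂ (<⇒≤ (≰⇒> U′≱))
    ...   | yes U′≥ = inj₁ (i , +-cancelʳ-≤ (6 * t) _ _ (begin
      10 * t + 6 * t      ≡⟨ *-distribʳ-+ t 10 6 ⟨
      16 * t              ≡⟨ N≡16t ⟨
      N                   ≡⟨ count-true N ⟨
      count {N} (λ _ → true)
        ≤⟨ sum-≤-+ {f = λ _ → 1} {[_] ∘ component i} cover ⟩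
      count (component i) + sum (λ b → [ union is b ] + ([ outside (i ∷ is) b ] + load c b))
        ≡⟨ cong (count (component i) +_) (∑-distrib-+ ([_] ∘ union is) _) ⟩
      count (component i) + (count (union is) + sum (λ b → [ outside (i ∷ is) b ] + load c b))
        ≡⟨ cong (λ x → count (component i) + (count (union is) + x))
             (∑-distrib-+ ([_] ∘ outside (i ∷ is)) (load c)) ⟩
      count (component i) + (count (union is) + (count (outside (i ∷ is)) + sum (load c)))
        ≤⟨ +-monoʳ-≤ (count (component i))
             (+-mono-≤ U≤ (+-mono-≤ (outside-small (i ∷ is) U′≥) (≤-trans (sum-load c) k≤2t))) ⟩
      count (component i) + (2 * t + (2 * t + 2 * t))
        ≡⟨ cong (λ x → count (component i) + (2 * t + x)) (*-distribʳ-+ t 2 2) ⟨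
      count (component i) + (2 * t + 4 * t)
        ≡⟨ cong (count (component i) +_) (*-distribʳ-+ t 2 4) ⟨
      count (component i) + 6 * t ∎))
      where
      open ≤-Reasoning
      cover : ∀ b → 1 ≤ [ component i b ] + ([ union is b ] + ([ outside (i ∷ is) b ] + load c b))
      cover b with component i b | union is b | 1≤clean+load b
      ... | true  | _     | _ = s≤s z≤n
      ... | false | true  | _ = s≤s z≤n
      ... | false | false | 1≤ with clean b
      ...   | true  = s≤s z≤n
      ...   | false = 1≤

    -- Every clean block lies in its own component, so the union of all components misses at most 2t
    -- blocks and cannot stay below 2t.
    big-component : ∃[ i ] 10 * t ≤ count (component i)
    big-component with grow (allFin N)
    ... | inj₁ found = found
    ... | inj₂ U≤ = contradiction 16t≤4t (<⇒≱ (*-monoˡ-< t {4} {16} (m≤m+n 5 11)))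
      where
      open ≤-Reasoning
      cover : ∀ b → 1 ≤ [ union (allFin N) b ] + load c b
      cover b with clean b in clean-b | 1≤clean+load b
      ... | false | 1≤ = ≤-trans 1≤ (m≤n+m _ _)
      ... | true  | _
        rewrite ⇒union {allFin N} b (∈-allFin b)
                  (⇒component b b clean-b (nil (clean⇒∉ clean-b base))) = s≤s z≤n
      16t≤4t : 16 * t ≤ 4 * t
      16t≤4t = begin
        16 * t                                  ≡⟨ N≡16t ⟨
        N                                       ≡⟨ count-true N ⟨
        count {N} (λ _ → true)                  ≤⟨ sum-≤-+ cover ⟩
        count (union (allFin N)) + sum (load c) ≤⟨ +-mono-≤ U≤ (≤-trans (sum-load c) k≤2t) ⟩
        2 * t + 2 * t                           ≡⟨ *-distribʳ-+ t 2 2 ⟨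
        4 * t                                   ∎

    good : ∃[ r ] Good c r
    good with big-component
    ... | i , big = centre i , component i , big , λ b b∈ → proj₂ (component⇒ i b b∈)

  ¬¬-good : ∀ {k} (c : Cops n k) → k ≤ 2 * t → ¬ ¬ (∃[ r ] Good c r)
  ¬¬-good c k≤2t ¬good =
    ¬¬-∀ (λ i → ¬¬-∀ (λ b → ¬¬-excluded-middle)) λ connected? →
      ¬good (Components.good c k≤2t connected?)

  meet : (S S′ : Fin N → Bool) → 10 * t ≤ count S → 10 * t ≤ count S′ →
         ¬ ¬ (∃[ b ] (S b ≡ true × S′ b ≡ true))
  meet S S′ S≥ S′≥ disjoint =
    contradiction 20t≤16t (<⇒≱ (*-monoˡ-< t {16} {20} (m≤m+n 17 3)))
    where
    open ≤-Reasoning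
    cover : ∀ b → [ S b ] + [ S′ b ] ≤ 1
    cover b with S b in eq | S′ b in eq′
    ... | true  | true  = contradiction (b , eq , eq′) disjoint
    ... | true  | false = s≤s z≤n
    ... | false | true  = s≤s z≤n
    ... | false | false = z≤n
    20t≤16t : 20 * t ≤ 16 * t
    20t≤16t = begin
      20 * t                         ≡⟨ *-distribʳ-+ t 10 10 ⟩
      10 * t + 10 * t                ≤⟨ +-mono-≤ S≥ S′≥ ⟩
      count S + count S′             ≡⟨ ∑-distrib-+ ([_] ∘ S) ([_] ∘ S′) ⟨
      sum (λ b → [ S b ] + [ S′ b ]) ≤⟨ sum-mono cover ⟩
      count {N} (λ _ → true)         ≡⟨ count-true N ⟩
      N                              ≡⟨ N≡16t ⟩
      16 * t                         ∎

  -- The large component for `just r ∷ c` shares a block with the present one. The path to that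
  -- block, cut after its last visit to `r`, begins with a step `w` that is legal against every cop
  -- move.
  escape : ∀ {k} {c : Cops n k} {r} → suc k ≤ 2 * t → Good c r →
           ¬ ¬ (∃[ w ] (r ~ w × just w ∉ᵛ just r ∷ c × Good (just r ∷ c) w))
  escape {c = c} {r} k<2t (S , S≥ , path) ¬escape =
    ¬¬-good (just r ∷ c) k<2t λ { (v , S′ , S′≥ , path′) →
    meet S S′ S≥ S′≥ λ { (b , b∈S , b∈S′) →
    case after-last-visit G
           (λ { eq → target∉ G (path′ b b∈S′) (Anyᵛ.here (cong just eq)) }) (path b b∈S) of
    λ { (w , r~w , p) → ¬escape
      (w , r~w , source∉ G p , S′ , S′≥ ,
       -- From `w` to the shared block, back to `v`, and on to any block of `S′`.
       λ b′ b′∈ → _++ᵖ_ G p (_++ᵖ_ G (reverseᵖ G (path′ b b∈S′)) (path′ b′ b′∈))) } } }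

  -- Induction on the winning tree. The actual position after the move occupies no more than
  -- `just r ∷ c`, so the paths found against the latter survive and the number of cops stays `k`.
  good⇒¬CopsWin : ∀ {k} {c : Cops n k} {r} → suc k ≤ 2 * t → Good c r → ¬ CopsWin G c r
  good⇒¬CopsWin k<2t good (turn move continue) =
    escape k<2t good λ { (w , r~w , w∉ , S , S≥ , path) →
      good⇒¬CopsWin k<2t (S , S≥ , λ b b∈ → weaken G (∈-CopMove move) (path b b∈))
        (continue w r~w (w∉ ∘ ∈-CopMove move)) }

  2t≤ent : 2 * t ≤ ent G
  2t≤ent = ≮⇒≥ λ ent<2t →
    ¬¬-good (replicate (ent G) nothing) (<⇒≤ ent<2t) λ { (r , good) →
      good⇒¬CopsWin ent<2t good (proj₁ (ent-isEntanglement G) r) }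

-- Cycles as permutations, and cubic graphs built from them.

-- A permutation without orbits of length 1 or 2: its orbits are genuine cycles of a simple graph.
record Rotation (X : Set) : Set where
  field
    next prev : X → X
    next-prev : ∀ x → next (prev x) ≡ x
    prev-next : ∀ x → prev (next x) ≡ x
    next≢id   : ∀ x → next x ≢ x
    next≢prev : ∀ x → next x ≢ prev x

  prev≢id : ∀ x → prev x ≢ x
  prev≢id x eq = next≢id x (trans (cong next (sym eq)) (next-prev x))

open Rotation using (next; prev; next-prev; prev-next; next≢id; next≢prev)

rotate : ∀ n → Rotation (Fin (3 + n))
rotate n = record
  { next = up ; prev = down ; next-prev = up-down ; prev-next = down-up
  ; next≢id = up≢id ; next≢prev = up≢down }
  where
  up down : Fin (3 + n) → Fin (3 + n)
  up i with view i
  ... | ‵fromℕ     = zero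
  ... | ‵inject₁ j = suc j
  down zero    = fromℕ _
  down (suc i) = inject₁ i

  up-down : ∀ i → up (down i) ≡ i
  up-down zero    rewrite view-fromℕ (2 + n) = refl
  up-down (suc i) rewrite view-inject₁ i     = refl

  down-up : ∀ i → down (up i) ≡ i
  down-up i with view i
  ... | ‵fromℕ     = refl
  ... | ‵inject₁ j = refl

  toℕ-up : ∀ i → toℕ (up i) ≡ suc (toℕ i) ⊎ (toℕ i ≡ 2 + n × up i ≡ zero)
  toℕ-up i with view i
  ... | ‵fromℕ     = inj₂ (toℕ-fromℕ (2 + n) , refl)
  ... | ‵inject₁ j = inj₁ (cong suc (sym (toℕ-inject₁ j)))

  up≢id : ∀ i → up i ≢ i
  up≢id i eq with toℕ-up i
  ... | inj₁ suc-i        = 1+n≢n (trans (sym suc-i) (cong toℕ eq))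
  ... | inj₂ (top , zero-i) = 0≢1+n (trans (cong toℕ (trans (sym zero-i) eq)) top)

  up≢down : ∀ i → up i ≢ down i
  up≢down zero ()
  up≢down (suc i) eq with toℕ-up (suc i)
  ... | inj₁ suc-i          = m+1+n≢m (toℕ i) {1}
    (trans (+-comm (toℕ i) 2) (trans (sym suc-i) (trans (cong toℕ eq) (toℕ-inject₁ i))))
  -- At the wrap-around the predecessor of the top element has index `1 + n`, which is not 0 because
  -- the length is at least 3.
  ... | inj₂ (top , zero-i) = 0≢1+n
    (trans (cong toℕ (trans (sym zero-i) eq)) (trans (toℕ-inject₁ i) (suc-injective top)))

-- Transitivity of the rotation, put as an induction principle so that it applies directly to the
-- existence of a path.
Connected : ∀ {X} → Rotation X → Set₁
Connected {X} rot = (P : X → Set) → (∀ x → P x → P (next rot x)) → (∀ x → P x → P (prev rot x)) →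
                    ∀ x y → P x → P y

rotate-connected : ∀ n → Connected (rotate n)
rotate-connected n P P-next P-prev i j p =
  -- The inner induction descends from `i` to 0, the outer one climbs from 0 to `j`.
  <-weakInduction P
    (<-weakInduction (λ i → P i → P zero) (λ p → p) (λ i down p → down (P-prev (suc i) p)) i p)
    (λ i p → subst P (next-prev (rotate n) (suc i)) (P-next (inject₁ i) p)) j

-- A 2-factor together with a perfect matching that shares no edge with it.
record CubicGenerators (V : Set) : Set where
  field
    rotation : Rotation V
    μ        : V → V
    μ-invol  : ∀ v → μ (μ v) ≡ v
    μ≢id     : ∀ v → μ v ≢ v
    μ≢next   : ∀ v → μ v ≢ next rotation v

  μ≢prev : ∀ v → μ v ≢ prev rotation v
  μ≢prev v eq = μ≢next (μ v) (trans (μ-invol v)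
    (sym (trans (cong (next rotation) eq) (next-prev rotation v))))

module Cubic {n V} (enum : Fin n ↔ V) (_≟_ : DecidableEquality V) (gens : CubicGenerators V) where
  open Inverse enum using (to; from; strictlyInverseˡ; strictlyInverseʳ)
  open CubicGenerators gens

  Edge : V → V → Set
  Edge x y = y ≡ next rotation x ⊎ y ≡ prev rotation x ⊎ y ≡ μ x

  Edge-sym : ∀ {x y} → Edge x y → Edge y x
  Edge-sym (inj₁ refl)        = inj₂ (inj₁ (sym (prev-next rotation _)))
  Edge-sym (inj₂ (inj₁ refl)) = inj₁ (sym (next-prev rotation _))
  Edge-sym (inj₂ (inj₂ refl)) = inj₂ (inj₂ (sym (μ-invol _)))

  Edge-irrefl : ∀ x → ¬ Edge x x
  Edge-irrefl x (inj₁ eq)        = next≢id rotation x (sym eq)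
  Edge-irrefl x (inj₂ (inj₁ eq)) = Rotation.prev≢id rotation x (sym eq)
  Edge-irrefl x (inj₂ (inj₂ eq)) = μ≢id x (sym eq)

  edge? : ∀ x y → Dec (Edge x y)
  edge? x y = y ≟ next rotation x ⊎-dec y ≟ prev rotation x ⊎-dec y ≟ μ x

  graph : Graph n
  graph = record
    { _~_      = λ v w → Edge (to v) (to w)
    ; _~?_     = λ v w → edge? (to v) (to w)
    ; ~-sym    = Edge-sym
    ; ~-irrefl = λ { refl → Edge-irrefl _ } }

  count-to≟ : ∀ y → count (λ w → does (to w ≟ y)) ≡ 1
  count-to≟ y = trans (sum-cong-≗ same) (count-≟ (from y))
    where
    same : ∀ w → [ does (to w ≟ y) ] ≡ [ does (w ≟ᶠ from y) ]
    same w = cong [_] (does-⇔ (mk⇔ (λ { refl → sym (strictlyInverseʳ w) })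
                                   (λ { refl → strictlyInverseˡ y })) (to w ≟ y) (w ≟ᶠ from y))

  regular : Regular 3 graph
  regular v = begin
    Graph.degree graph v                    ≡⟨ ∣tabulate∣ (λ w → does (edge? x (to w))) ⟩
    count (λ w → does (edge? x (to w)))     ≡⟨ sum-cong-≗ (λ w → split (to w)) ⟩
    sum (λ w → is (next rotation x) w + (is (prev rotation x) w + is (μ x) w))
                                            ≡⟨ ∑-distrib-+ (is (next rotation x)) _ ⟩
    sum (is (next rotation x)) + sum (λ w → is (prev rotation x) w + is (μ x) w)
                                            ≡⟨ cong₂ _+_ (count-to≟ _) (∑-distrib-+ (is (prev rotation x)) (is (μ x))) ⟩
    1 + (sum (is (prev rotation x)) + sum (is (μ x)))
                                            ≡⟨ cong₂ (λ i j → 1 + (i + j)) (count-to≟ _) (count-to≟ _) ⟩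
    3                                       ∎
    where
    open ≡-Reasoning
    x : V
    x = to v
    is : V → Fin n → ℕ
    is y w = [ does (to w ≟ y) ]
    -- The three neighbours are distinct, so at most one of the indicators is 1 and they add up.
    split : ∀ y → [ does (edge? x y) ] ≡
            [ does (y ≟ next rotation x) ] + ([ does (y ≟ prev rotation x) ] + [ does (y ≟ μ x) ])
    split y with y ≟ next rotation x | y ≟ prev rotation x | y ≟ μ x
    ... | yes p | yes q | _     = contradiction (trans (sym p) q) (next≢prev rotation x)
    ... | yes p | no _  | yes r = contradiction (trans (sym r) p) (μ≢next x)
    ... | no _  | yes q | yes r = contradiction (trans (sym r) q) (μ≢prev x)
    ... | yes _ | no _  | no _  = refl
    ... | no _  | yes _ | no _  = refl
    ... | no _  | no _  | yes _ = refl
    ... | no _  | no _  | no _  = refl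

-- The cubic graph from two copies of the matched cycles.

module Construction
  (m q t T₀ R : ℕ) .{{_ : NonZero m}} .{{_ : NonZero t}} .{{_ : NonZero T₀}}
  (m*m≡1+q : m * m ≡ suc q) (decay : 3 ^ m * q ^ T₀ < suc q ^ T₀) (m≡16 : m ≡ 16)
  (rotᴸ : Rotation (Fin (2 * T₀))) (connected : Connected rotᴸ) (base : Fin (2 * T₀))
  where

  private module D = Design m q t T₀ m*m≡1+q decay
  open D using (N; L; Point; _≟ₚ_)

  -- Two copies of N cycles of length L and of one further cycle; a point left unmatched
  -- by D.μ is joined to its twin in the other copy.
  Vertex : Set
  Vertex = Bool × (Point ⊎ Fin (3 + R))

  _≟ᵥ_ : DecidableEquality Vertex
  _≟ᵥ_ = ×-≡-dec _≟ᵇ_ (⊎-≡-dec _≟ₚ_ _≟ᶠ_)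

  enum : Fin (2 * (N * L + (3 + R))) ↔ Vertex
  enum = (2↔Bool ×-↔ ((*↔× ⊎-↔ ↔-id _) ↔-∘ +↔⊎)) ↔-∘ *↔×

  rotationᵥ : Rotation Vertex
  rotationᵥ = record
    { next = λ { (c , inj₁ (b , p)) → c , inj₁ (b , next rotᴸ p)
               ; (c , inj₂ r)       → c , inj₂ (next (rotate R) r) }
    ; prev = λ { (c , inj₁ (b , p)) → c , inj₁ (b , prev rotᴸ p)
               ; (c , inj₂ r)       → c , inj₂ (prev (rotate R) r) }
    ; next-prev = λ { (c , inj₁ (b , p)) → cong (λ p → c , inj₁ (b , p)) (next-prev rotᴸ p)
                    ; (c , inj₂ r)       → cong (λ r → c , inj₂ r) (next-prev (rotate R) r) }
    ; prev-next = λ { (c , inj₁ (b , p)) → cong (λ p → c , inj₁ (b , p)) (prev-next rotᴸ p)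
                    ; (c , inj₂ r)       → cong (λ r → c , inj₂ r) (prev-next (rotate R) r) }
    ; next≢id = λ { (c , inj₁ (b , p)) →
                      next≢id rotᴸ p ∘ ,-injectiveʳ ∘ inj₁-injective ∘ ,-injectiveʳ
                  ; (c , inj₂ r)       → next≢id (rotate R) r ∘ inj₂-injective ∘ ,-injectiveʳ }
    ; next≢prev = λ { (c , inj₁ (b , p)) →
                        next≢prev rotᴸ p ∘ ,-injectiveʳ ∘ inj₁-injective ∘ ,-injectiveʳ
                    ; (c , inj₂ r)       → next≢prev (rotate R) r ∘ inj₂-injective ∘ ,-injectiveʳ }
    }

  not≢ : ∀ c → not c ≢ c
  not≢ c eq = not-¬ refl (sym eq)

  mate : Vertex → Vertex
  mate (c , inj₁ x) with D.μ x ≟ₚ x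
  ... | yes _ = not c , inj₁ x
  ... | no  _ = c , inj₁ (D.μ x)
  mate (c , inj₂ r) = not c , inj₂ r

  mate-fixed : ∀ c {x} → D.μ x ≡ x → mate (c , inj₁ x) ≡ (not c , inj₁ x)
  mate-fixed c {x} fixed with D.μ x ≟ₚ x
  ... | yes _    = refl
  ... | no moved = contradiction fixed moved

  mate-moved : ∀ c {x} → D.μ x ≢ x → mate (c , inj₁ x) ≡ (c , inj₁ (D.μ x))
  mate-moved c {x} moved with D.μ x ≟ₚ x
  ... | yes fixed = contradiction fixed moved
  ... | no _      = refl

  mate-invol : ∀ v → mate (mate v) ≡ v
  mate-invol (c , inj₁ x) with D.μ x ≟ₚ x
  ... | yes fixed = trans (mate-fixed (not c) fixed) (cong (_, inj₁ x) (not-involutive c))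
  ... | no moved  = trans (mate-moved c (λ eq → moved (trans (sym eq) (D.μ-invol x))))
                          (cong (λ y → c , inj₁ y) (D.μ-invol x))
  mate-invol (c , inj₂ r) = cong (_, inj₂ r) (not-involutive c)

  mate≢id : ∀ v → mate v ≢ v
  mate≢id (c , inj₁ x) eq with D.μ x ≟ₚ x
  ... | yes _    = not≢ c (,-injectiveˡ eq)
  ... | no moved = moved (inj₁-injective (,-injectiveʳ eq))
  mate≢id (c , inj₂ r) eq = not≢ c (,-injectiveˡ eq)

  -- A rotation step keeps both copy and block, whereas a mate lies in the other copy or, by
  -- `D.μ-far`, in another block.
  mate≢next : ∀ v → mate v ≢ next rotationᵥ v
  mate≢next (c , inj₁ (b , p)) eq with D.μ (b , p) ≟ₚ (b , p) | D.μ-far (b , p)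
  ... | yes _    | _          = not≢ c (,-injectiveˡ eq)
  ... | no moved | inj₁ fixed = moved fixed
  ... | no _     | inj₂ far   = far (,-injectiveˡ (inj₁-injective (,-injectiveʳ eq)))
  mate≢next (c , inj₂ r) eq = not≢ c (,-injectiveˡ eq)

  generators : CubicGenerators Vertex
  generators = record
    { rotation = rotationᵥ ; μ = mate ; μ-invol = mate-invol
    ; μ≢id = mate≢id ; μ≢next = mate≢next }

  open Cubic enum _≟ᵥ_ generators using (graph; regular; Edge) public
  open Graph graph using (_~_)
  open Inverse enum using (to; from; strictlyInverseˡ)

  -- The robber's blocks are the cycles of the copy `false`, where the edges of `D.μ` already join
  -- any two large disjoint sets.
  vertex : Fin N → Fin L → Fin (2 * (N * L + (3 + R)))
  vertex b p = from (false , inj₁ (b , p))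

  vertex-edge : ∀ {a p b q} → Edge (false , inj₁ (a , p)) (false , inj₁ (b , q)) →
                vertex a p ~ vertex b q
  vertex-edge = subst₂ Edge (sym (strictlyInverseˡ _)) (sym (strictlyInverseˡ _))

  -- Both copies of a cycle carry the same label; a cop still counts against at most one block.
  blockOf : Vertex → Maybe (Fin N)
  blockOf (_ , inj₁ (b , _)) = just b
  blockOf (_ , inj₂ _)       = nothing

  block-path : ∀ {k} {c : Cops _ k} b → (∀ p → just (vertex b p) ∉ᵛ c) →
               ∀ p q → Path graph c (vertex b p) (vertex b q)
  block-path {c = c} b clear p q =
    connected (λ q → Path graph c (vertex b p) (vertex b q))
      (λ q → extend (inj₁ refl)) (λ q → extend (inj₂ (inj₁ refl))) p q (nil (clear p))
    where
    extend : ∀ {q q′} → Edge (false , inj₁ (b , q)) (false , inj₁ (b , q′)) →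
             Path graph c (vertex b p) (vertex b q) → Path graph c (vertex b p) (vertex b q′)
    extend {q} {q′} e path = _++ᵖ_ graph path (cons (clear q) (vertex-edge e) (nil (clear q′)))

  separate : (A B : Fin N → Bool) → (∀ b → A b ≡ true → B b ≢ true) →
             2 * t ≤ count A → 2 * t ≤ count B →
             ∃[ a ] ∃[ p ] ∃[ b ] ∃[ q ] (A a ≡ true × B b ≡ true × vertex a p ~ vertex b q)
  separate A B disjoint A≥ B≥ with D.hits (λ b → colour (A b) (B b))
      (≤-trans A≥ (sum-mono λ b → ≤-reflexive (cong [_] (sym (inA-colour (A b) (B b))))) ,
       ≤-trans B≥ (sum-mono λ b → ≤-reflexive (cong [_] (sym (inB-colour (disjoint b))))))
  ... | (a , p) , moved , Aa , Bb =
    a , p , _ , _ , trans (sym (inA-colour (A a) (B a))) Aa ,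
    trans (sym (inB-colour (disjoint _))) Bb ,
    vertex-edge (inj₂ (inj₂ (sym (mate-moved false moved))))

  2t≤ent : 2 * t ≤ ent graph
  2t≤ent = Robber.2t≤ent {t = t} graph (cong (_* t) m≡16) vertex (blockOf ∘ to)
    (λ b p → cong blockOf (strictlyInverseˡ (false , inj₁ (b , p)))) base block-path separate

-- Rational constants and all large even orders.

open import Data.Integer.Base as ℤ using (+_)
import Data.Integer.Properties as ℤ

-- Cross-multiplication, carried out on unnormalised fractions, where numerators and denominators
-- are explicit.
1/k*n<e : ∀ k n e → n < suc k * e → (+ 1 ℚ./ suc k) ℚ.* (+ n ℚ./ 1) ℚ.< (+ e ℚ./ 1)
1/k*n<e k n e n<ke = ℚ.toℚᵘ-cancel-< (begin-strict
  toℚᵘ ((+ 1 ℚ./ suc k) ℚ.* (+ n ℚ./ 1))  ≃⟨ ℚ.toℚᵘ-homo-* (+ 1 ℚ./ suc k) (+ n ℚ./ 1) ⟩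
  toℚᵘ (+ 1 ℚ./ suc k) ℚᵘ.* toℚᵘ (+ n ℚ./ 1)
    ≃⟨ ℚᵘ.*-cong (ℚ.toℚᵘ-fromℚᵘ (mkℚᵘ (+ 1) k)) (ℚ.toℚᵘ-fromℚᵘ (mkℚᵘ (+ n) 0)) ⟩
  mkℚᵘ (+ 1) k ℚᵘ.* mkℚᵘ (+ n) 0          <⟨ *<* (subst₂ ℤ._<_ (numˡ n) (numʳ e) (ℤ.+<+ n<ke)) ⟩
  mkℚᵘ (+ e) 0                            ≃⟨ ℚ.toℚᵘ-fromℚᵘ (mkℚᵘ (+ e) 0) ⟨
  toℚᵘ (+ e ℚ./ 1)                        ∎)
  where
  open ℚᵘ.≤-Reasoning
  numˡ : ∀ n → + n ≡ (+ 1 ℤ.* + n) ℤ.* + 1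
  numˡ n = sym (trans (ℤ.*-identityʳ _) (ℤ.*-identityˡ (+ n)))
  numʳ : ∀ e → + (suc k * e) ≡ + e ℤ.* + (suc k * 1)
  numʳ e = trans (cong +_ (trans (*-comm (suc k) e) (cong (e *_) (sym (*-identityʳ (suc k))))))
                 (ℤ.pos-* e (suc k * 1))

0<1/k : ∀ k → 0ℚ ℚ.< (+ 1 ℚ./ suc k)
0<1/k k = ℚ.positive⁻¹ _ {{ℚ.normalize-pos 1 (suc k)}}

linear-entanglement : ∀ m q T₀ ℓ → .{{_ : NonZero m}} .{{_ : NonZero T₀}} → m ≡ 16 → m * m ≡ suc q →
  3 ^ m * q ^ T₀ < suc q ^ T₀ → 2 * T₀ ≡ 3 + ℓ →
  Σ[ α ∈ ℚ ] (0ℚ ℚ.< α × (Σ[ n₀ ∈ ℕ ] (∀ n → n₀ ≤ n → 2 ∣ n →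
    Σ[ G ∈ Graph n ] (Regular 3 G × α ℚ.* (+ n ℚ./ 1) ℚ.< (+ ent G ℚ./ 1)))))
linear-entanglement m q T₀ ℓ m≡16 m*m≡1+q decay L≡3+ℓ =
  -- One copy has `B` cycle points per unit of `t`. The order is at most 6Bt, less than (8B+1)t, and
  -- `n₀` ensures that `t` is at least 1.
  + 1 ℚ./ suc (8 * B) , 0<1/k (8 * B) , 2 * (3 + B) , G
  where
  B : ℕ
  B = m * (2 * T₀)
  instance
    L≢0 : NonZero (2 * T₀)
    L≢0 = m*n≢0 2 T₀
    B≢0 : NonZero B
    B≢0 = m*n≢0 m (2 * T₀)

  3≤B : 3 ≤ B
  3≤B = ≤-trans (subst (3 ≤_) (sym L≡3+ℓ) (m≤m+n 3 ℓ)) (m≤n*m (2 * T₀) m)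

  -- The further cycle has at most 2B points, hence at most 2Bt, so each copy has at most 3Bt;
  -- strictness comes from the 1 in `suc (8 * B)`.
  size-bound : ∀ t R e .{{_ : NonZero t}} → R < B → 2 * t ≤ e →
               2 * (m * t * (2 * T₀) + (3 + R)) < suc (8 * B) * e
  size-bound t R e R<B 2t≤e = begin-strict
    2 * (m * t * (2 * T₀) + (3 + R))
      ≤⟨ *-monoʳ-≤ 2 (+-monoʳ-≤ (m * t * (2 * T₀)) (+-mono-≤ 3≤B (<⇒≤ R<B))) ⟩
    2 * (m * t * (2 * T₀) + (B + B))
      ≤⟨ *-monoʳ-≤ 2 (+-monoʳ-≤ (m * t * (2 * T₀)) (+-mono-≤ (m≤m*n B t) (m≤m*n B t))) ⟩
    2 * (m * t * (2 * T₀) + (B * t + B * t))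
      ≡⟨ regroup m t (2 * T₀) ⟩
    6 * B * t          ≤⟨ *-monoˡ-≤ t (*-monoˡ-≤ B {6} {8} (m≤m+n 6 2)) ⟩
    8 * B * t          <⟨ m<n+m (8 * B * t) (>-nonZero⁻¹ t) ⟩
    suc (8 * B) * t    ≤⟨ *-monoʳ-≤ (suc (8 * B)) (≤-trans (m≤n*m t 2) 2t≤e) ⟩
    suc (8 * B) * e    ∎
    where
    open ≤-Reasoning
    regroup : ∀ m t L → 2 * (m * t * L + (m * L * t + m * L * t)) ≡ 6 * (m * L) * t
    regroup = solve-∀

  rotation : ∀ {L} → L ≡ 3 + ℓ → Σ[ rot ∈ Rotation (Fin L) ] (Connected rot × Fin L)
  rotation refl = rotate ℓ , rotate-connected ℓ , zero

  GraphOn : ℕ → Set₁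
  GraphOn n = Σ[ G ∈ Graph n ]
    (Regular 3 G × (+ 1 ℚ./ suc (8 * B)) ℚ.* (+ n ℚ./ 1) ℚ.< (+ ent G ℚ./ 1))

  graphOn : ∀ t R .{{_ : NonZero t}} → R < B → GraphOn (2 * (m * t * (2 * T₀) + (3 + R)))
  graphOn t R R<B = bound (expander (rotation L≡3+ℓ))
    where
    order : ℕ
    order = 2 * (m * t * (2 * T₀) + (3 + R))
    expander : Σ[ rot ∈ Rotation (Fin (2 * T₀)) ] (Connected rot × Fin (2 * T₀)) →
               Σ[ G ∈ Graph order ] (Regular 3 G × 2 * t ≤ ent G)
    expander (rot , connected , base) = graph , regular , 2t≤ent
      where open Construction m q t T₀ R m*m≡1+q decay m≡16 rot connected base
    bound : Σ[ G ∈ Graph order ] (Regular 3 G × 2 * t ≤ ent G) → GraphOn order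
    bound (G , reg , 2t≤) = G , reg , 1/k*n<e (8 * B) order (ent G) (size-bound t R (ent G) R<B 2t≤)

  -- Half of `n`, less 3, is divided by `B`: the quotient gives `t`, and the further cycle of length
  -- `3 + R` absorbs the remainder.
  G : ∀ n → 2 * (3 + B) ≤ n → 2 ∣ n → GraphOn n
  G n n₀≤n (divides h n≡h*2) = subst GraphOn (sym size) (graphOn t R (m%n<n (h ∸ 3) B))
    where
    3+B≤h : 3 + B ≤ h
    3+B≤h = *-cancelˡ-≤ 2 (subst (2 * (3 + B) ≤_) (trans n≡h*2 (*-comm h 2)) n₀≤n)
    t R : ℕ
    t = (h ∸ 3) / B
    R = (h ∸ 3) % B
    instance
      t≢0 : NonZero t
      t≢0 = >-nonZero (m≥n⇒m/n>0 (m+n≤o⇒m≤o∸n B (subst (_≤ h) (+-comm 3 B) 3+B≤h)))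
    regroup : ∀ R t m L → 3 + (R + t * (m * L)) ≡ m * t * L + (3 + R)
    regroup = solve-∀
    size : n ≡ 2 * (m * t * (2 * T₀) + (3 + R))
    size = trans n≡h*2 (trans (*-comm h 2) (cong (2 *_)
      (trans (sym (m+[n∸m]≡n (≤-trans (m≤m+n 3 B) 3+B≤h)))
      (trans (cong (λ x → 3 + x) (m≡m%n+[m/n]*n (h ∸ 3) B)) (regroup R t m (2 * T₀))))))

-- 4500 exceeds 16 ln 3 / ln (256/255), and the cycles have length 2 * 4500 = 3 + 8997.
corollary1 : Σ[ α ∈ ℚ ] (0ℚ ℚ.< α × (Σ[ n₀ ∈ ℕ ] (∀ n → n₀ ≤ n → 2 ∣ n →
    Σ[ G ∈ Graph n ] (Regular 3 G × α ℚ.* (+ n ℚ./ 1) ℚ.< (+ ent G ℚ./ 1)))))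
corollary1 = linear-entanglement 16 255 4500 8997 refl refl
  (<ᵇ⇒< (3 ^ 16 * 255 ^ 4500) (256 ^ 4500) tt) refl
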